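{- For every fixed integer $k\ge 2$, as $n\to\infty$, $$\left(\frac{1}{k^{1+1/k}}-o(1)\right)n^{1/k}\le m^0(n,\mathcal F_k)\le m^+(n,\mathcal C_{k,k})\le(2k+o(1))\,m^+(n,\mathcal F_k)\le(2k+o(1))\,n^{1/k}.$$
   Context: Digraphs have no loops and no parallel edges (opposite edges are allowed). A directed walk of length $k$ is a sequence $v_0v_1\cdots v_k$ of vertices with each $(v_i,v_{i+1})$ an edge. $\mathcal F_k$ is the family of all digraphs that are the union of two distinct directed walks of length $k$ having the same initial vertex and the same terminal vertex. $C_{\ell,\ell}$ is the digraph consisting of two vertices $x,y$ joined by two internally vertex-disjoint paths with $\ell$ edges each, both oriented from $x$ to $y$; $\mathcal C_{k,k}=\{C_{2,2},\ldots,C_{k,k}\}$. A digraph is $\mathcal F$-free if it has no subgraph isomorphic to a member of $\mathcal F$. For a family $\mathcal F$, $m^+(n,\mathcal F)$ (resp. $m^0(n,\mathcal F)$) is the largest possible minimum outdegree (resp. minimum semidegree $\min\{\delta^+,\delta^-\}$) of an $n$-vertex $\mathcal F$-free digraph. -}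

module Defs where

open import Data.Nat using (ℕ; zero; suc; _+_; _*_; _^_; _≤_; _<_; _⊓_)
open import Data.Bool using (Bool; true; false; if_then_else_)
open import Data.Fin using (Fin; zero; suc; inject₁; fromℕ)
open import Data.List using (List; map; allFin)
open import Data.Nat.ListAction using (sum)
open import Data.Product using (Σ; ∃; ∃-syntax; _×_; _,_)
open import Data.Sum using (_⊎_)
open import Data.Empty using (⊥)
open import Relation.Nullary using (¬_)
open import Relation.Binary.PropositionalEquality using (_≡_)
open import Function using (_∘_)
open import Function.Definitions using (Injective)

-- A digraph on vertex set Fin n: adjacency relation E, no loops.
-- (A Bool-valued relation automatically excludes parallel edges.)
record Digraph (n : ℕ) : Set where
  field
    E        : Fin n → Fin n → Bool
    loopless : ∀ v → E v v ≡ false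
open Digraph public

Edge : ∀ {n} → Digraph n → Fin n → Fin n → Set
Edge D u v = E D u v ≡ true

Family : Set₁
Family = (h : ℕ) → Digraph h → Set

IsWalk : ∀ {h} → Digraph h → (k : ℕ) → (Fin (suc k) → Fin h) → Set
IsWalk H k w = ∀ (i : Fin k) → Edge H (w (inject₁ i)) (w (suc i))

𝓕 : ℕ → Family
𝓕 k h H =
  Σ (Fin (suc k) → Fin h) λ w₁ → Σ (Fin (suc k) → Fin h) λ w₂ →
    IsWalk H k w₁ × IsWalk H k w₂
    × ¬ (∀ i → w₁ i ≡ w₂ i)
    × w₁ zero ≡ w₂ zero
    × w₁ (fromℕ k) ≡ w₂ (fromℕ k)
    × (∀ u v → Edge H u v →
         (∃[ i ] (w₁ (inject₁ i) ≡ u × w₁ (suc i) ≡ v))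
         ⊎ (∃[ i ] (w₂ (inject₁ i) ≡ u × w₂ (suc i) ≡ v)))
    × (∀ v → (∃[ i ] w₁ i ≡ v) ⊎ (∃[ i ] w₂ i ≡ v))

IsC : ℕ → Family
IsC ℓ h H =
  Σ (Fin (suc ℓ) → Fin h) λ P → Σ (Fin (suc ℓ) → Fin h) λ Q →
    Injective _≡_ _≡_ P × Injective _≡_ _≡_ Q
    × P zero ≡ Q zero
    × P (fromℕ ℓ) ≡ Q (fromℕ ℓ)
    × (∀ i j → P i ≡ Q j →
         (i ≡ zero × j ≡ zero) ⊎ (i ≡ fromℕ ℓ × j ≡ fromℕ ℓ))
    × (∀ u v → Edge H u v →
         (∃[ i ] (P (inject₁ i) ≡ u × P (suc i) ≡ v))
         ⊎ (∃[ i ] (Q (inject₁ i) ≡ u × Q (suc i) ≡ v)))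
    × (∀ (i : Fin ℓ) → Edge H (P (inject₁ i)) (P (suc i)))
    × (∀ (i : Fin ℓ) → Edge H (Q (inject₁ i)) (Q (suc i)))
    × (∀ v → (∃[ i ] P i ≡ v) ⊎ (∃[ j ] Q j ≡ v))

𝓒 : ℕ → Family
𝓒 k h H = Σ ℕ λ ℓ → 2 ≤ ℓ × ℓ ≤ k × IsC ℓ h H

_↪_ : ∀ {h n} → Digraph h → Digraph n → Set
_↪_ {h} {n} H D = Σ (Fin h → Fin n) λ φ →
  Injective _≡_ _≡_ φ × (∀ u v → Edge H u v → Edge D (φ u) (φ v))

Free : Family → ∀ {n} → Digraph n → Set
Free F D = ∀ h (H : Digraph h) → F h H → ¬ (H ↪ D)

outdeg : ∀ {n} → Digraph n → Fin n → ℕ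
outdeg {n} D v = sum (map (λ w → if E D v w then 1 else 0) (allFin n))

indeg : ∀ {n} → Digraph n → Fin n → ℕ
indeg {n} D v = sum (map (λ w → if E D w v then 1 else 0) (allFin n))

-- minimum of a function over Fin n (convention: 0 for n = 0)
minOver : (n : ℕ) → (Fin n → ℕ) → ℕ
minOver zero f = 0
minOver (suc zero) f = f zero
minOver (suc (suc n)) f = f zero ⊓ minOver (suc n) (f ∘ suc)

δ⁺ : ∀ {n} → Digraph n → ℕ
δ⁺ {n} D = minOver n (outdeg D)

δ⁻ : ∀ {n} → Digraph n → ℕ
δ⁻ {n} D = minOver n (indeg D)

δ⁰ : ∀ {n} → Digraph n → ℕ
δ⁰ D = δ⁺ D ⊓ δ⁻ D

IsMPlus : Family → ℕ → ℕ → Set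
IsMPlus F n m =
  (Σ (Digraph n) λ D → Free F D × δ⁺ D ≡ m)
  × (∀ (D : Digraph n) → Free F D → δ⁺ D ≤ m)

IsMZero : Family → ℕ → ℕ → Set
IsMZero F n m =
  (Σ (Digraph n) λ D → Free F D × δ⁰ D ≡ m)
  × (∀ (D : Digraph n) → Free F D → δ⁰ D ≤ m)

{-# OPTIONS --safe #-}
module Submission where

-- All three extremal functions are n^{1/k} + O(1). Write m^k ≤ n < (m+1)^k.
--
-- Lower bound: in the Reddy–Imase digraph u → m u + r (mod n), 0 ≤ r < m, the walks of length
-- k from x end at m^k x + T with T running over [0, m^k), one walk for each T, so it is
-- 𝓕_k-free; all in- and outdegrees are m, or m - 1 once loops are removed.
--
-- Upper bound: search breadth-first from a vertex of a 𝓒_{k,k}-free digraph. Each vertex a at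
-- distance i < k has at least δ⁺ - k out-neighbours off a fixed geodesic to a, and for distinct
-- a these sets are disjoint, since a common element would close two geodesics, from their last
-- common vertex on, to some C_{ℓ,ℓ}. So every ball is at least δ⁺ - k - 2 times larger than the
-- previous one, and m⁺(n, 𝓒_{k,k}) ≤ m + k + 2.
--
-- An 𝓕_k-free digraph with δ⁺ ≥ 1 is 𝓒_{k,k}-free, which orders the three functions.

open import Defs
open import Data.Nat using (ℕ; zero; suc; _+_; _*_; _^_; _≤_; _<_; _∸_; s≤s⁻¹; z≤n; s≤s; _≤?_; NonZero; >-nonZero)
open import Data.Nat.Properties
open import Data.Nat.DivMod
open import Data.Nat.Solver using (module +-*-Solver)
open import Data.Nat.ListAction using (sum)
open import Data.Bool using (Bool; true; false; if_then_else_)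
import Data.Bool.Properties as Bool
open import Data.Fin using (Fin; zero; suc; inject₁; fromℕ; toℕ; fromℕ<)
open import Data.Fin.Properties using (any?; toℕ-inject₁; toℕ-fromℕ; toℕ-injective; toℕ<n; toℕ-fromℕ<; toℕ≤pred[n])
import Data.Fin.Properties as Fin
open import Data.Fin.Relation.Unary.Top using (view; ‵fromℕ; ‵inj₁)
open import Data.List using (List; []; _∷_; _++_; map; allFin; length; filter; lookup; concatMap; applyUpTo; tabulate)
open import Data.List.Properties using (length-++; length-applyUpTo; length-tabulate)
open import Data.List.Membership.Propositional using (_∈_; _∉_; find)
import Data.List.Membership.DecPropositional as DecMembership
open import Data.List.Membership.Propositional.Properties using (∈-filter⁺; ∈-filter⁻; ∈-allFin; ∈-lookup; ∈-++⁺ˡ; ∈-++⁺ʳ; ∈-++⁻; ∈-∃++; ∈-concatMap⁻; ∈-applyUpTo⁺; ∈-tabulate⁻)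
open import Data.List.Relation.Binary.Disjoint.Propositional using (Disjoint)
open import Data.List.Relation.Unary.All as All using (All; []; _∷_)
open import Data.List.Relation.Unary.AllPairs using ([]; _∷_)
open import Data.List.Relation.Unary.Any as Any using (here; there; index)
open import Data.List.Relation.Unary.Any.Properties using (lookup-index)
open import Data.List.Relation.Unary.Unique.Propositional using (Unique)
open import Data.List.Relation.Unary.Unique.Propositional.Properties using (allFin⁺; filter⁺; tabulate⁺; ++⁺)
open import Data.Product using (Σ; ∃-syntax; _×_; _,_; proj₁; proj₂)
open import Data.Sum using (_⊎_; inj₁; inj₂)
open import Data.Empty using (⊥; ⊥-elim)
open import Function using (_∘_; id)
open import Function.Definitions using (Injective)
open import Relation.Nullary using (¬_; Dec; yes; no; does; contradiction; ¬?; _×-dec_; _⊎-dec_)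
open import Relation.Nullary.Decidable using (dec-true; dec-false)
open import Relation.Unary using (Decidable)
open import Relation.Binary.Definitions using (tri<; tri≈; tri>)
open import Relation.Binary.PropositionalEquality using (_≡_; _≢_; refl; sym; trans; cong; cong₂; subst; subst₂; module ≡-Reasoning)

open +-*-Solver using (solve; con; _:+_; _:*_; _:=_)

-- Counting with lists without repetition

does-true⁻ : ∀ {P : Set} (P? : Dec P) → does P? ≡ true → P
does-true⁻ (yes p) _ = p

-- Pigeonhole by induction: deleting one occurrence of the head `x` from `ys` leaves a list that
-- still contains the tail, because `x` does not recur there.
unique-⊆⇒length-≤ : ∀ {A : Set} {xs ys : List A} → Unique xs →
  (∀ {v} → v ∈ xs → v ∈ ys) → length xs ≤ length ys
unique-⊆⇒length-≤ {xs = []} _ _ = z≤n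
unique-⊆⇒length-≤ {xs = x ∷ xs} {ys} (x∉xs ∷ uxs) sub
  with as , bs , refl ← ∈-∃++ (sub (here refl)) = begin
    suc (length xs)             ≤⟨ s≤s (unique-⊆⇒length-≤ uxs sub′) ⟩
    suc (length (as ++ bs))     ≡⟨ cong suc (length-++ as) ⟩
    suc (length as + length bs) ≡⟨ sym (+-suc _ _) ⟩
    length as + suc (length bs) ≡⟨ sym (length-++ as) ⟩
    length (as ++ x ∷ bs)       ∎
  where
  open ≤-Reasoning
  sub′ : ∀ {v} → v ∈ xs → v ∈ as ++ bs
  sub′ v∈xs with ∈-++⁻ as (sub (there v∈xs))
  ... | inj₁ v∈as         = ∈-++⁺ˡ v∈as
  ... | inj₂ (here v≡x)   = contradiction (sym v≡x) (All.lookup x∉xs v∈xs)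
  ... | inj₂ (there v∈bs) = ∈-++⁺ʳ as v∈bs

unique-lookup-injective : ∀ {A : Set} {xs : List A} → Unique xs → Injective _≡_ _≡_ (lookup xs)
unique-lookup-injective (_ ∷ _) {zero} {zero} _ = refl
unique-lookup-injective {xs = _ ∷ xs} (x∉xs ∷ _) {zero} {suc j} eq =
  contradiction eq (All.lookup x∉xs (∈-lookup j))
unique-lookup-injective {xs = _ ∷ xs} (x∉xs ∷ _) {suc i} {zero} eq =
  contradiction (sym eq) (All.lookup x∉xs (∈-lookup i))
unique-lookup-injective (_ ∷ uxs) {suc i} {suc j} eq = cong suc (unique-lookup-injective uxs eq)

-- Disjointness of the blocks takes the form that a common element forces equal indices, which is
-- what `fresh-disjoint` supplies.
concatMap-unique : ∀ {A B : Set} (N : A → List B) {as : List A} → Unique as →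
  (∀ {a} → a ∈ as → Unique (N a)) →
  (∀ {a a′ b} → a ∈ as → a′ ∈ as → b ∈ N a → b ∈ N a′ → a ≡ a′) →
  Unique (concatMap N as)
concatMap-unique N {[]} _ _ _ = []
concatMap-unique N {a ∷ as} (a∉as ∷ uas) uN disj =
  ++⁺ (uN (here refl))
      (concatMap-unique N uas (uN ∘ there) (λ p q → disj (there p) (there q)))
      apart
  where
  apart : Disjoint (N a) (concatMap N as)
  apart {b} (b∈Na , b∈rest) = go a∉as there (∈-concatMap⁻ N {xs = as} b∈rest)
    where
    -- `disj` speaks of indices in the full list, so the descent into suffixes carries the inclusion
    -- `inc` along.
    go : ∀ {cs} → All (a ≢_) cs → (∀ {c} → c ∈ cs → c ∈ a ∷ as) → Any.Any ((b ∈_) ∘ N) cs → ⊥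
    go (a≢c ∷ _) inc (here b∈Nc) = a≢c (disj (here refl) (inc (here refl)) b∈Na b∈Nc)
    go (_ ∷ r)   inc (there p)   = go r (inc ∘ there) p

length-concatMap-≥ : ∀ {A B : Set} (N : A → List B) e {as : List A} →
  (∀ {a} → a ∈ as → e ≤ length (N a)) → length as * e ≤ length (concatMap N as)
length-concatMap-≥ N e {[]} _ = z≤n
length-concatMap-≥ N e {a ∷ as} h = begin
  e + length as * e                     ≤⟨ +-mono-≤ (h (here refl)) (length-concatMap-≥ N e (h ∘ there)) ⟩
  length (N a) + length (concatMap N as) ≡⟨ sym (length-++ (N a)) ⟩
  length (concatMap N (a ∷ as))         ∎
  where open ≤-Reasoning

members : ∀ {n} {P : Fin n → Set} → Decidable P → List (Fin n)
members {n} P? = filter P? (allFin n)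

∈-members : ∀ {n} {P : Fin n → Set} (P? : Decidable P) {v} → P v → v ∈ members P?
∈-members P? = ∈-filter⁺ P? (∈-allFin _)

members-∈ : ∀ {n} {P : Fin n → Set} (P? : Decidable P) {v} → v ∈ members P? → P v
members-∈ {n} P? v∈ = proj₂ (∈-filter⁻ P? {xs = allFin n} v∈)

members-unique : ∀ {n} {P : Fin n → Set} (P? : Decidable P) → Unique (members P?)
members-unique P? = filter⁺ P? (allFin⁺ _)

members-≤ : ∀ {n} {P : Fin n → Set} (P? : Decidable P) {ys : List (Fin n)} →
  (∀ {v} → P v → v ∈ ys) → length (members P?) ≤ length ys
members-≤ P? sub = unique-⊆⇒length-≤ (members-unique P?) (sub ∘ members-∈ P?)

≤-members : ∀ {n} {P : Fin n → Set} (P? : Decidable P) {xs : List (Fin n)} → Unique xs →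
  (∀ {v} → v ∈ xs → P v) → length xs ≤ length (members P?)
≤-members P? uxs sub = unique-⊆⇒length-≤ uxs (∈-members P? ∘ sub)

sum-indicator : ∀ {A : Set} (b : A → Bool) xs →
  sum (map (λ w → if b w then 1 else 0) xs) ≡ length (filter (λ w → b w Bool.≟ true) xs)
sum-indicator b [] = refl
sum-indicator b (x ∷ xs) with b x
... | true  = cong suc (sum-indicator b xs)
... | false = sum-indicator b xs

minOver-≤ : ∀ {n} (f : Fin n → ℕ) i → minOver n f ≤ f i
minOver-≤ {suc zero} f zero = ≤-refl
minOver-≤ {suc (suc n)} f zero = m⊓n≤m _ _
minOver-≤ {suc (suc n)} f (suc i) = ≤-trans (m⊓n≤n (f zero) _) (minOver-≤ (f ∘ suc) i)

-- An empty minimum is 0 by convention, so a positive `c` would fail there.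
≤-minOver : ∀ {n} .{{_ : NonZero n}} (f : Fin n → ℕ) {c} → (∀ i → c ≤ f i) → c ≤ minOver n f
≤-minOver {suc zero} f h = h zero
≤-minOver {suc (suc n)} f h = ⊓-glb (h zero) (≤-minOver (f ∘ suc) (h ∘ suc))

-- The union of two walks as a member of a forbidden family

module PairSubgraph {n} (D : Digraph n) {ℓ} (f g : Fin (suc ℓ) → Fin n)
                    (f-walk : IsWalk D ℓ f) (g-walk : IsWalk D ℓ g) where

  On : Fin n → Set
  On v = (∃[ i ] f i ≡ v) ⊎ (∃[ i ] g i ≡ v)

  On? : Decidable On
  On? v = any? (λ i → f i Fin.≟ v) ⊎-dec any? (λ i → g i Fin.≟ v)

  -- Members of a family live on some `Fin h`, so a vertex of the union is renamed to its position
  -- in the repetition-free list of visited vertices.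
  h : ℕ
  h = length (members On?)

  φ : Fin h → Fin n
  φ = lookup (members On?)

  φ-injective : Injective _≡_ _≡_ φ
  φ-injective = unique-lookup-injective (members-unique On?)

  φ⁻¹ : ∀ {v} → On v → Fin h
  φ⁻¹ o = index (∈-members On? o)

  φ-φ⁻¹ : ∀ {v} (o : On v) → φ (φ⁻¹ o) ≡ v
  φ-φ⁻¹ o = sym (lookup-index (∈-members On? o))

  Step : Fin n → Fin n → Set
  Step u v = (∃[ i ] (f (inject₁ i) ≡ u × f (suc i) ≡ v))
           ⊎ (∃[ i ] (g (inject₁ i) ≡ u × g (suc i) ≡ v))

  Step? : ∀ u v → Dec (Step u v)
  Step? u v = any? (λ i → (f (inject₁ i) Fin.≟ u) ×-dec (f (suc i) Fin.≟ v))
        ⊎-dec any? (λ i → (g (inject₁ i) Fin.≟ u) ×-dec (g (suc i) Fin.≟ v))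

  step-edge : ∀ {u v} → Step u v → Edge D u v
  step-edge (inj₁ (i , refl , refl)) = f-walk i
  step-edge (inj₂ (i , refl , refl)) = g-walk i

  -- Only pairs traversed by one of the walks become edges: both families demand that the two walks
  -- cover every edge, which the induced subgraph may violate.
  H : Digraph h
  H .E u v = does (Step? (φ u) (φ v))
  H .loopless v = dec-false (Step? _ _) λ s →
    contradiction (trans (sym (step-edge s)) (loopless D (φ v))) λ ()

  embedding : H ↪ D
  embedding = φ , φ-injective , λ u v e → step-edge (does-true⁻ (Step? _ _) e)

  f′ g′ : Fin (suc ℓ) → Fin h
  f′ i = φ⁻¹ (inj₁ (i , refl))
  g′ i = φ⁻¹ (inj₂ (i , refl))

  φ-f′ : ∀ i → φ (f′ i) ≡ f i
  φ-f′ i = φ-φ⁻¹ (inj₁ (i , refl))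

  φ-g′ : ∀ i → φ (g′ i) ≡ g i
  φ-g′ i = φ-φ⁻¹ (inj₂ (i , refl))

  f′-walk : IsWalk H ℓ f′
  f′-walk i = dec-true (Step? _ _) (inj₁ (i , sym (φ-f′ _) , sym (φ-f′ _)))

  g′-walk : IsWalk H ℓ g′
  g′-walk i = dec-true (Step? _ _) (inj₂ (i , sym (φ-g′ _) , sym (φ-g′ _)))

  f′≡ : ∀ {i u} → f i ≡ φ u → f′ i ≡ u
  f′≡ eq = φ-injective (trans (φ-f′ _) eq)

  g′≡ : ∀ {i u} → g i ≡ φ u → g′ i ≡ u
  g′≡ eq = φ-injective (trans (φ-g′ _) eq)

  edges-covered : ∀ u v → Edge H u v →
    (∃[ i ] (f′ (inject₁ i) ≡ u × f′ (suc i) ≡ v)) ⊎ (∃[ i ] (g′ (inject₁ i) ≡ u × g′ (suc i) ≡ v))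
  edges-covered u v e with does-true⁻ (Step? _ _) e
  ... | inj₁ (i , p , q) = inj₁ (i , f′≡ p , f′≡ q)
  ... | inj₂ (i , p , q) = inj₂ (i , g′≡ p , g′≡ q)

  vertices-covered : ∀ v → (∃[ i ] f′ i ≡ v) ⊎ (∃[ i ] g′ i ≡ v)
  vertices-covered v with members-∈ On? (∈-lookup v)
  ... | inj₁ (i , p) = inj₁ (i , f′≡ p)
  ... | inj₂ (i , p) = inj₂ (i , g′≡ p)

  f′≡f′⇒ : ∀ {i j} → f′ i ≡ f′ j → f i ≡ f j
  f′≡f′⇒ eq = trans (sym (φ-f′ _)) (trans (cong φ eq) (φ-f′ _))

  g′≡g′⇒ : ∀ {i j} → g′ i ≡ g′ j → g i ≡ g j
  g′≡g′⇒ eq = trans (sym (φ-g′ _)) (trans (cong φ eq) (φ-g′ _))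

  f′≡g′⇒ : ∀ {i j} → f′ i ≡ g′ j → f i ≡ g j
  f′≡g′⇒ eq = trans (sym (φ-f′ _)) (trans (cong φ eq) (φ-g′ _))

  f′≡g′⇐ : ∀ {i j} → f i ≡ g j → f′ i ≡ g′ j
  f′≡g′⇐ eq = φ-injective (trans (φ-f′ _) (trans eq (sym (φ-g′ _))))

-- If the walks differed, their union would be a member of `𝓕 k`. The double negation mirrors `𝓕`,
-- where difference is a negated pointwise equality.
𝓕-free⇒walks-unique : ∀ {n k} (D : Digraph n) → Free (𝓕 k) D → ∀ {f g} →
  IsWalk D k f → IsWalk D k g → f zero ≡ g zero → f (fromℕ k) ≡ g (fromℕ k) →
  ¬ ¬ (∀ i → f i ≡ g i)
𝓕-free⇒walks-unique D free {f} {g} f-walk g-walk start end distinct =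
  free h H (f′ , g′ , f′-walk , g′-walk , (λ same → distinct (λ i → f′≡g′⇒ (same i)))
           , f′≡g′⇐ start , f′≡g′⇐ end , edges-covered , vertices-covered) embedding
  where open PairSubgraph D f g f-walk g-walk

𝓒-free⇒no-disjoint-paths : ∀ {n k} (D : Digraph n) → Free (𝓒 k) D → ∀ {ℓ} → 2 ≤ ℓ → ℓ ≤ k → ∀ {f g} →
  IsWalk D ℓ f → IsWalk D ℓ g → Injective _≡_ _≡_ f → Injective _≡_ _≡_ g →
  f zero ≡ g zero → f (fromℕ ℓ) ≡ g (fromℕ ℓ) →
  ¬ (∀ i j → f i ≡ g j → (i ≡ zero × j ≡ zero) ⊎ (i ≡ fromℕ ℓ × j ≡ fromℕ ℓ))
𝓒-free⇒no-disjoint-paths D free {ℓ} 2≤ℓ ℓ≤k {f} {g} f-walk g-walk f-inj g-inj start end disjoint =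
  free h H (ℓ , 2≤ℓ , ℓ≤k , f′ , g′ , f-inj ∘ f′≡f′⇒ , g-inj ∘ g′≡g′⇒ , f′≡g′⇐ start , f′≡g′⇐ end
           , (λ i j → disjoint i j ∘ f′≡g′⇒) , edges-covered , f′-walk , g′-walk , vertices-covered)
    embedding
  where open PairSubgraph D f g f-walk g-walk

-- Out-neighbours and the extension of walks

outNeighbours : ∀ {n} → Digraph n → Fin n → List (Fin n)
outNeighbours D v = members (λ w → E D v w Bool.≟ true)

δ⁺≤length-outNeighbours : ∀ {n} (D : Digraph n) v → δ⁺ D ≤ length (outNeighbours D v)
δ⁺≤length-outNeighbours {n} D v =
  ≤-trans (minOver-≤ (outdeg D) v) (≤-reflexive (sum-indicator (E D v) (allFin n)))

∃-outNeighbour : ∀ {n} (D : Digraph n) → 1 ≤ δ⁺ D → ∀ v → ∃[ w ] Edge D v w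
∃-outNeighbour D 1≤δ v with outNeighbours D v in eq | ≤-trans 1≤δ (δ⁺≤length-outNeighbours D v)
... | w ∷ ws | _ = w , members-∈ _ (subst (w ∈_) (sym eq) (here refl))

module Extend {n} (D : Digraph n) (next : ∀ v → ∃[ w ] Edge D v w) where

  follow : Fin n → ℕ → Fin n
  follow v zero    = v
  follow v (suc t) = follow (proj₁ (next v)) t

  follow-edge : ∀ v t → Edge D (follow v t) (follow v (suc t))
  follow-edge v zero    = proj₂ (next v)
  follow-edge v (suc t) = follow-edge (proj₁ (next v)) t

  extend : ∀ {ℓ} → (Fin (suc ℓ) → Fin n) → ℕ → Fin n
  extend {zero}  f t       = follow (f zero) t
  extend {suc ℓ} f zero    = f zero
  extend {suc ℓ} f (suc t) = extend (f ∘ suc) t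

  extend-zero : ∀ {ℓ} (f : Fin (suc ℓ) → Fin n) → extend f 0 ≡ f zero
  extend-zero {zero}  f = refl
  extend-zero {suc ℓ} f = refl

  extend-edge : ∀ {ℓ} (f : Fin (suc ℓ) → Fin n) → IsWalk D ℓ f →
    ∀ t → Edge D (extend f t) (extend f (suc t))
  extend-edge {zero}  f _ t = follow-edge (f zero) t
  extend-edge {suc ℓ} f w zero =
    subst (Edge D (f zero)) (sym (extend-zero (f ∘ suc))) (w zero)
  extend-edge {suc ℓ} f w (suc t) = extend-edge (f ∘ suc) (w ∘ suc) t

  -- Beyond its own steps an extended walk depends only on its last vertex, since `next` is one
  -- fixed choice. Walks with a common end therefore stay together.
  extend-+ : ∀ {ℓ} (f : Fin (suc ℓ) → Fin n) t → extend f (ℓ + t) ≡ follow (f (fromℕ ℓ)) t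
  extend-+ {zero}  f t = refl
  extend-+ {suc ℓ} f t = extend-+ (f ∘ suc) t

-- Sequences on `ℕ` can be shifted and extended without index coercions; they are cut to `Fin` only
-- where a family requires it.
ℕ-walk : ∀ {n} (D : Digraph n) (w : ℕ → Fin n) k →
  (∀ t → t < k → Edge D (w t) (w (suc t))) → IsWalk D k (w ∘ toℕ)
ℕ-walk D w k e i =
  subst (λ s → Edge D (w s) (w (suc (toℕ i)))) (sym (toℕ-inject₁ i)) (e (toℕ i) (toℕ<n i))

-- A copy of C_{ℓ,ℓ} with ℓ ≤ k becomes two walks of length k by following the same
-- out-edges from its terminal vertex.
𝓕-free⇒𝓒-free : ∀ {n k} (D : Digraph n) → 1 ≤ δ⁺ D → Free (𝓕 k) D → Free (𝓒 k) D
𝓕-free⇒𝓒-free {k = k} D 1≤δ free h H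
  (suc (suc l) , s≤s (s≤s _) , ℓ≤k , P , Q , P-inj , Q-inj , start , end , disjoint , _ , P-walk , Q-walk , _)
  (φ , φ-inj , φ-edge) =
  𝓕-free⇒walks-unique D free
    (ℕ-walk D p k (λ t _ → extend-edge (φ ∘ P) p-walk t)) (ℕ-walk D q k (λ t _ → extend-edge (φ ∘ Q) q-walk t))
    (cong φ start)
    (subst (λ s → p s ≡ q s) (sym (trans (toℕ-fromℕ k) (sym (m+[n∸m]≡n ℓ≤k))))
      (trans (extend-+ (φ ∘ P) j) (trans (cong (λ v → follow (φ v) j) end) (sym (extend-+ (φ ∘ Q) j)))))
    differ
  where
  open Extend D (∃-outNeighbour D 1≤δ)
  j : ℕ
  j = k ∸ suc (suc l)
  p q : ℕ → Fin _
  p = extend (φ ∘ P)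
  q = extend (φ ∘ Q)
  p-walk : IsWalk D (suc (suc l)) (φ ∘ P)
  p-walk i = φ-edge _ _ (P-walk i)
  q-walk : IsWalk D (suc (suc l)) (φ ∘ Q)
  q-walk i = φ-edge _ _ (Q-walk i)
  1<1+k : 1 < suc k
  1<1+k = s≤s (≤-trans (s≤s z≤n) ℓ≤k)
  -- Position 1 separates the walks: the paths have length at least 2, so it is an inner index,
  -- where `P` and `Q` cannot meet.
  differ : ¬ (∀ i → p (toℕ i) ≡ q (toℕ i))
  differ same with disjoint (suc zero) (suc zero)
                     (φ-inj (subst (λ t → p t ≡ q t) (toℕ-fromℕ< 1<1+k) (same (fromℕ< 1<1+k))))
  ... | inj₁ (() , _)
  ... | inj₂ (() , _)

-- Forks in a digraph without `𝓒 k`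

lastAgreement : ∀ {n} (P Q : ℕ → Fin n) i → P 0 ≡ Q 0 → P i ≢ Q i →
  ∃[ j ] (j < i × P j ≡ Q j × (∀ t → j < t → t ≤ i → P t ≢ Q t))
-- The downward search stops at 0 at the latest, where the walks agree.
lastAgreement P Q zero start differ = contradiction start differ
lastAgreement P Q (suc i) start differ with P i Fin.≟ Q i
... | yes Pi≡Qi = i , ≤-refl , Pi≡Qi ,
  λ t i<t t≤1+i → subst (λ s → P s ≢ Q s) (≤-antisym i<t t≤1+i) differ
... | no Pi≢Qi with lastAgreement P Q i start Pi≢Qi
...   | j , j<i , Pj≡Qj , after = j , m<n⇒m<1+n j<i , Pj≡Qj , λ t j<t t≤1+i →
  case-≤ t j<t (m≤n⇒m<n∨m≡n t≤1+i)
  where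
  case-≤ : ∀ t → j < t → t < suc i ⊎ t ≡ suc i → P t ≢ Q t
  case-≤ t j<t (inj₁ (s≤s t≤i)) = after t j<t t≤i
  case-≤ t j<t (inj₂ refl)      = differ

-- Two walks that meet again after their last agreement j form a C_{ℓ,ℓ} with ℓ = i + 1 - j.
𝓒-free⇒no-fork : ∀ {n k} (D : Digraph n) → Free (𝓒 k) D → ∀ {i} → i < k → (P Q : ℕ → Fin n) →
  (∀ t → t ≤ i → Edge D (P t) (P (suc t))) → (∀ t → t ≤ i → Edge D (Q t) (Q (suc t))) →
  (∀ s t → s ≤ suc i → t ≤ suc i → P s ≡ P t → s ≡ t) →
  (∀ s t → s ≤ suc i → t ≤ suc i → Q s ≡ Q t → s ≡ t) →
  (∀ s t → s ≤ suc i → t ≤ suc i → P s ≡ Q t → s ≡ t) →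
  P 0 ≡ Q 0 → P (suc i) ≡ Q (suc i) → P i ≡ Q i
𝓒-free⇒no-fork D free {i} i<k P Q P-edge Q-edge PP QQ PQ start end with P i Fin.≟ Q i
... | yes eq = eq
... | no differ with lastAgreement P Q i start differ
...   | j , j<i , Pj≡Qj , after =
  ⊥-elim (𝓒-free⇒no-disjoint-paths D free 2≤ℓ (≤-trans (m∸n≤m (suc i) j) i<k)
    (ℕ-walk D (λ t → P (j + t)) ℓ (λ t t<ℓ → shifted P P-edge t t<ℓ))
    (ℕ-walk D (λ t → Q (j + t)) ℓ (λ t t<ℓ → shifted Q Q-edge t t<ℓ))
    (λ eq → cancel (PP _ _ (bound _) (bound _) eq))
    (λ eq → cancel (QQ _ _ (bound _) (bound _) eq))
    (subst (λ s → P s ≡ Q s) (sym (+-identityʳ j)) Pj≡Qj)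
    (subst (λ s → P s ≡ Q s) (sym (trans (cong (j +_) (toℕ-fromℕ ℓ)) j+ℓ)) end)
    disjoint)
  where
  ℓ : ℕ
  ℓ = suc i ∸ j
  j+ℓ : j + ℓ ≡ suc i
  j+ℓ = m+[n∸m]≡n (m≤n⇒m≤1+n (<⇒≤ j<i))
  -- The walks differ at `i`, so `j` is strictly smaller than `i` and the fork has at least two
  -- edges on each side.
  2≤ℓ : 2 ≤ ℓ
  2≤ℓ = m+n≤o⇒m≤o∸n 2 (s≤s j<i)
  bound : (t : Fin (suc ℓ)) → j + toℕ t ≤ suc i
  bound t = subst (j + toℕ t ≤_) j+ℓ (+-monoʳ-≤ j (toℕ≤pred[n] t))
  cancel : ∀ {s t : Fin (suc ℓ)} → j + toℕ s ≡ j + toℕ t → s ≡ t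
  cancel eq = toℕ-injective (+-cancelˡ-≡ j _ _ eq)
  shifted : ∀ R → (∀ t → t ≤ i → Edge D (R t) (R (suc t))) →
            ∀ t → t < ℓ → Edge D (R (j + t)) (R (j + suc t))
  shifted R e t t<ℓ = subst (λ s → Edge D (R (j + t)) (R s)) (sym (+-suc j t))
    (e (j + t) (s≤s⁻¹ (subst (_≤ suc i) (+-suc j t) (subst (j + suc t ≤_) j+ℓ (+-monoʳ-≤ j t<ℓ)))))
  disjoint : ∀ s t → P (j + toℕ s) ≡ Q (j + toℕ t) →
    (s ≡ zero × t ≡ zero) ⊎ (s ≡ fromℕ ℓ × t ≡ fromℕ ℓ)
  -- By `PQ` a common vertex has the same index on both walks, and by the choice of `j` no index
  -- strictly between `j` and `i + 1` is possible.
  disjoint s t eq with refl ← cancel {s} {t} (PQ _ _ (bound s) (bound t) eq) with s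
  ... | zero = inj₁ (refl , refl)
  ... | s@(suc s′) with m≤n⇒m<n∨m≡n (bound s)
  ...   | inj₁ (s≤s le) = contradiction eq (after _ (m<m+n j (s≤s z≤n)) le)
  ...   | inj₂ top = inj₂ (s≡ , s≡)
    where
    s≡ : s ≡ fromℕ ℓ
    s≡ = toℕ-injective (trans (+-cancelˡ-≡ j _ _ (trans top (sym j+ℓ))) (sym (toℕ-fromℕ ℓ)))

snoc : ∀ {A : Set} → (ℕ → A) → ℕ → A → ℕ → A
snoc P i z t with t ≤? i
... | yes _ = P t
... | no _  = z

snoc-≤ : ∀ {A : Set} (P : ℕ → A) {i} z {t} → t ≤ i → snoc P i z t ≡ P t
snoc-≤ P {i} z {t} t≤i with t ≤? i
... | yes _  = refl
... | no t≰i = contradiction t≤i t≰i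

snoc-> : ∀ {A : Set} (P : ℕ → A) i z → snoc P i z (suc i) ≡ z
snoc-> P i z with suc i ≤? i
... | yes i<i = contradiction i<i 1+n≰n
... | no _    = refl

snoc-edge : ∀ {n} (D : Digraph n) {P i z} → (∀ t → t < i → Edge D (P t) (P (suc t))) →
  Edge D (P i) z → ∀ t → t ≤ i → Edge D (snoc P i z t) (snoc P i z (suc t))
snoc-edge D {P} {i} {z} P-edge last t t≤i with m≤n⇒m<n∨m≡n t≤i
... | inj₁ t<i  = subst₂ (Edge D) (sym (snoc-≤ P z t≤i)) (sym (snoc-≤ P z t<i)) (P-edge t t<i)
... | inj₂ refl = subst₂ (Edge D) (sym (snoc-≤ P z ≤-refl)) (sym (snoc-> P i z)) last

-- Breadth-first search and the growth of balls

module BreadthFirst {n} (D : Digraph n) (x : Fin n) where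

  open DecMembership (Fin._≟_ {n}) using (_∈?_)

  Ball : ℕ → Fin n → Set
  Ball zero    v = v ≡ x
  Ball (suc i) v = Ball i v ⊎ (∃[ u ] (Ball i u × Edge D u v))

  Ball? : ∀ i → Decidable (Ball i)
  Ball? zero    v = v Fin.≟ x
  Ball? (suc i) v = Ball? i v ⊎-dec any? (λ u → Ball? i u ×-dec (E D u v Bool.≟ true))

  ball-mono : ∀ {i j v} → i ≤ j → Ball i v → Ball j v
  ball-mono {j = zero}  z≤n b = b
  ball-mono {j = suc j} i≤1+j b with m≤n⇒m<n∨m≡n i≤1+j
  ... | inj₁ (s≤s i≤j) = inj₁ (ball-mono i≤j b)
  ... | inj₂ refl      = b

  Sphere : ℕ → Fin n → Set
  Sphere zero    v = Ball zero v
  Sphere (suc i) v = Ball (suc i) v × ¬ Ball i v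

  Sphere? : ∀ i → Decidable (Sphere i)
  Sphere? zero    v = Ball? zero v
  Sphere? (suc i) v = Ball? (suc i) v ×-dec ¬? (Ball? i v)

  sphere⇒ball : ∀ i {v} → Sphere i v → Ball i v
  sphere⇒ball zero    s = s
  sphere⇒ball (suc i) s = proj₁ s

  sphere-≮ : ∀ {i j v} → Sphere i v → Sphere j v → ¬ (i < j)
  sphere-≮ {i} {suc j} sᵢ (_ , ¬b) (s≤s i≤j) = ¬b (ball-mono i≤j (sphere⇒ball i sᵢ))

  sphere-unique : ∀ {i j v} → Sphere i v → Sphere j v → i ≡ j
  sphere-unique sᵢ sⱼ = ≤-antisym (≮⇒≥ (sphere-≮ sⱼ sᵢ)) (≮⇒≥ (sphere-≮ sᵢ sⱼ))

  -- The field `level` makes the walk shortest. It also forces a vertex shared by two geodesics to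
  -- have the same index on both.
  record Geodesic (i : ℕ) (P : ℕ → Fin n) : Set where
    field
      start : P 0 ≡ x
      edge  : ∀ t → t < i → Edge D (P t) (P (suc t))
      level : ∀ t → t ≤ i → Sphere t (P t)
  open Geodesic

  -- Were `u` already in the previous ball, `v` would lie in `Ball i`.
  sphere-pred : ∀ i {u v} → Ball i u → Edge D u v → ¬ Ball i v → Sphere i u
  sphere-pred zero    b e ¬b = b
  sphere-pred (suc i) b e ¬b = b , λ b′ → ¬b (inj₂ (_ , b′ , e))

  geodesic : ∀ i {a} → Sphere i a → ∃[ P ] (Geodesic i P × P i ≡ a)
  geodesic zero {a} a≡x = (λ _ → a) , record
    { start = a≡x ; edge = λ _ () ; level = λ { zero _ → a≡x } } , refl
  geodesic (suc i) (inj₁ b , ¬b) = contradiction b ¬b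
  geodesic (suc i) {a} s@(inj₂ (u , b , e) , ¬b) with geodesic i (sphere-pred i b e ¬b)
  ... | P , P-geo , refl = snoc P i a , record
    { start = start P-geo
    ; edge  = λ { t (s≤s t≤i) → snoc-edge D (edge P-geo) e t t≤i }
    ; level = lev } , snoc-> P i a
    where
    lev : ∀ t → t ≤ suc i → Sphere t (snoc P i a t)
    lev t t≤1+i with m≤n⇒m<n∨m≡n t≤1+i
    ... | inj₁ (s≤s t≤i) = subst (Sphere t) (sym (snoc-≤ P a t≤i)) (level P-geo t t≤i)
    ... | inj₂ refl      = subst (Sphere (suc i)) (sym (snoc-> P i a)) s

  -- Fixes one geodesic per vertex of the sphere, so that `Fresh` can refer to it; off the sphere
  -- the value is a dummy.
  pathTo : ℕ → Fin n → ℕ → Fin n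
  pathTo i a with Sphere? i a
  ... | yes s = proj₁ (geodesic i s)
  ... | no _  = λ _ → x

  pathTo-geodesic : ∀ i {a} → Sphere i a → Geodesic i (pathTo i a) × pathTo i a i ≡ a
  pathTo-geodesic i {a} s with Sphere? i a
  ... | yes s′ = proj₂ (geodesic i s′)
  ... | no ¬s  = contradiction s ¬s

  onPathTo : ℕ → Fin n → List (Fin n)
  onPathTo i a = applyUpTo (pathTo i a) (suc i)

  -- Such a `z` may lie on any level up to `i + 1`, but appending it to the chosen geodesic still
  -- gives a path without repeated vertices.
  Fresh : ℕ → Fin n → Fin n → Set
  Fresh i a z = Edge D a z × z ∉ onPathTo i a

  Fresh? : ∀ i a → Decidable (Fresh i a)
  Fresh? i a z = (E D a z Bool.≟ true) ×-dec ¬? (z ∈? onPathTo i a)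

  δ⁺≤fresh+1+i : ∀ i a → δ⁺ D ≤ length (members (Fresh? i a)) + suc i
  δ⁺≤fresh+1+i i a = begin
    δ⁺ D                                                   ≤⟨ δ⁺≤length-outNeighbours D a ⟩
    length (outNeighbours D a)                             ≤⟨ members-≤ (λ w → E D a w Bool.≟ true) split ⟩
    length (members (Fresh? i a) ++ onPathTo i a)          ≡⟨ length-++ (members (Fresh? i a)) ⟩
    length (members (Fresh? i a)) + length (onPathTo i a)  ≡⟨ cong (length (members (Fresh? i a)) +_) (length-applyUpTo (pathTo i a) (suc i)) ⟩
    length (members (Fresh? i a)) + suc i                  ∎
    where
    open ≤-Reasoning
    split : ∀ {z} → Edge D a z → z ∈ members (Fresh? i a) ++ onPathTo i a
    split {z} e with z ∈? onPathTo i a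
    ... | yes z∈ = ∈-++⁺ʳ _ z∈
    ... | no z∉  = ∈-++⁺ˡ (∈-members (Fresh? i a) (e , z∉))

  -- Levels determine the indices up to `i`, and `z` lies on neither geodesic. With `P` and `Q`
  -- equal this is injectivity, so it serves all three index hypotheses of `𝓒-free⇒no-fork`.
  snoc-aligned : ∀ {i P Q z} → Geodesic i P → Geodesic i Q →
    z ∉ applyUpTo P (suc i) → z ∉ applyUpTo Q (suc i) →
    ∀ s t → s ≤ suc i → t ≤ suc i → snoc P i z s ≡ snoc Q i z t → s ≡ t
  snoc-aligned {i} {P} {Q} P-geo Q-geo z∉P z∉Q s t s≤ t≤ eq with s ≤? i | t ≤? i
  ... | yes s≤i | yes t≤i = sphere-unique (level P-geo s s≤i) (subst (Sphere t) (sym eq) (level Q-geo t t≤i))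
  ... | yes s≤i | no _    = contradiction (subst (_∈ applyUpTo P (suc i)) eq (∈-applyUpTo⁺ P (s≤s s≤i))) z∉P
  ... | no _    | yes t≤i = contradiction (subst (_∈ applyUpTo Q (suc i)) (sym eq) (∈-applyUpTo⁺ Q (s≤s t≤i))) z∉Q
  ... | no s≰i  | no t≰i  = trans (≤-antisym s≤ (≰⇒> s≰i)) (≤-antisym (≰⇒> t≰i) t≤)

  -- Both geodesics, prolonged by `z`, meet at index `i + 1`; as no fork is possible, they already
  -- agree at index `i`.
  fresh-disjoint : ∀ {k} → Free (𝓒 k) D → ∀ {i} → i < k → ∀ {a b z} →
    Sphere i a → Sphere i b → Fresh i a z → Fresh i b z → a ≡ b
  fresh-disjoint free {i} i<k {a} {b} {z} sa sb (a→z , z∉P) (b→z , z∉Q)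
    with pathTo-geodesic i sa | pathTo-geodesic i sb
  ... | P-geo , P≡a | Q-geo , Q≡b = begin
    a                        ≡⟨ sym P≡a ⟩
    P i                      ≡⟨ sym (snoc-≤ P z ≤-refl) ⟩
    snoc P i z i             ≡⟨ 𝓒-free⇒no-fork D free i<k (snoc P i z) (snoc Q i z)
                                  (snoc-edge D (edge P-geo) (subst (λ v → Edge D v z) (sym P≡a) a→z))
                                  (snoc-edge D (edge Q-geo) (subst (λ v → Edge D v z) (sym Q≡b) b→z))
                                  (snoc-aligned P-geo P-geo z∉P z∉P) (snoc-aligned Q-geo Q-geo z∉Q z∉Q)
                                  (snoc-aligned P-geo Q-geo z∉P z∉Q)
                                  (trans (start P-geo) (sym (start Q-geo)))
                                  (trans (snoc-> P i z) (sym (snoc-> Q i z))) ⟩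
    snoc Q i z i             ≡⟨ snoc-≤ Q z ≤-refl ⟩
    Q i                      ≡⟨ Q≡b ⟩
    b                        ∎
    where
    open ≡-Reasoning
    P Q : ℕ → Fin n
    P = pathTo i a
    Q = pathTo i b

  ∣Ball∣ ∣Sphere∣ : ℕ → ℕ
  ∣Ball∣ i   = length (members (Ball? i))
  ∣Sphere∣ i = length (members (Sphere? i))

  -- Each vertex of the sphere loses at most the `i + 1 ≤ k` vertices of its geodesic and keeps `e`
  -- fresh out-neighbours. These sets are disjoint and lie in the next ball, though perhaps not in
  -- the next sphere.
  sphere-expands : ∀ {k e} → Free (𝓒 k) D → e + k ≤ δ⁺ D → ∀ {i} → i < k →
    ∣Sphere∣ i * e ≤ ∣Ball∣ (suc i)
  sphere-expands {k} {e} free e+k≤δ {i} i<k =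
    ≤-trans (length-concatMap-≥ N e {members (Sphere? i)} (λ {a} _ → e≤ a))
      (≤-members (Ball? (suc i)) unique covered)
    where
    N : Fin n → List (Fin n)
    N a = members (Fresh? i a)
    e≤ : ∀ a → e ≤ length (N a)
    e≤ a = +-cancelʳ-≤ k e _ (≤-trans e+k≤δ (≤-trans (δ⁺≤fresh+1+i i a) (+-monoʳ-≤ _ i<k)))
    unique : Unique (concatMap N (members (Sphere? i)))
    unique = concatMap-unique N (members-unique (Sphere? i)) (λ {a} _ → members-unique (Fresh? i a))
      λ {a} {a′} a∈ a′∈ z∈ z∈′ → fresh-disjoint free i<k
        (members-∈ (Sphere? i) a∈) (members-∈ (Sphere? i) a′∈)
        (members-∈ (Fresh? i a) z∈) (members-∈ (Fresh? i a′) z∈′)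
    covered : ∀ {z} → z ∈ concatMap N (members (Sphere? i)) → Ball (suc i) z
    covered z∈ with find (∈-concatMap⁻ N {xs = members (Sphere? i)} z∈)
    ... | a , a∈ , z∈Na = inj₂ (a , sphere⇒ball i (members-∈ (Sphere? i) a∈)
                                  , proj₁ (members-∈ (Fresh? i a) z∈Na))

  ball≤sphere+ball : ∀ i → ∣Ball∣ (suc i) ≤ ∣Sphere∣ (suc i) + ∣Ball∣ i
  ball≤sphere+ball i = ≤-trans (members-≤ (Ball? (suc i)) split) (≤-reflexive (length-++ (members (Sphere? (suc i)))))
    where
    split : ∀ {v} → Ball (suc i) v → v ∈ members (Sphere? (suc i)) ++ members (Ball? i)
    split {v} b with Ball? i v
    ... | yes b′ = ∈-++⁺ʳ _ (∈-members (Ball? i) b′)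
    ... | no ¬b′ = ∈-++⁺ˡ (∈-members (Sphere? (suc i)) (b , ¬b′))

  -- A sphere is a ball minus the previous ball, so `(c + 2) * B ≤ B⁺ + (c + 2) * B⁻`. As `c ≥ 2`,
  -- the last term is at most `2 * c * B⁻`, hence by induction at most `2 * B`: the 2 added to `c`
  -- pays for passing from spheres to balls.
  ball-expands : ∀ {k c} → Free (𝓒 k) D → 2 ≤ c → c + 2 + k ≤ δ⁺ D → ∀ i → i < k →
    c * ∣Ball∣ i ≤ ∣Ball∣ (suc i)
  ball-expands {c = c} free 2≤c deg zero 0<k = begin
    c * ∣Ball∣ 0         ≡⟨ *-comm c _ ⟩
    ∣Sphere∣ 0 * c       ≤⟨ *-monoʳ-≤ (∣Sphere∣ 0) (m≤m+n c 2) ⟩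
    ∣Sphere∣ 0 * (c + 2) ≤⟨ sphere-expands free deg 0<k ⟩
    ∣Ball∣ 1             ∎
    where open ≤-Reasoning
  ball-expands {c = c} free 2≤c deg (suc i) i<k = +-cancelʳ-≤ (2 * B) (c * B) B⁺ (begin
    c * B + 2 * B             ≡⟨ sym (*-distribʳ-+ B c 2) ⟩
    (c + 2) * B               ≤⟨ *-monoʳ-≤ (c + 2) (ball≤sphere+ball i) ⟩
    (c + 2) * (S + B⁻)        ≡⟨ *-distribˡ-+ (c + 2) S B⁻ ⟩
    (c + 2) * S + (c + 2) * B⁻ ≤⟨ +-mono-≤ (≤-trans (≤-reflexive (*-comm (c + 2) S)) (sphere-expands free deg i<k)) (*-monoˡ-≤ B⁻ c+2≤2c) ⟩
    B⁺ + 2 * c * B⁻           ≡⟨ cong (B⁺ +_) (*-assoc 2 c B⁻) ⟩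
    B⁺ + 2 * (c * B⁻)         ≤⟨ +-monoʳ-≤ B⁺ (*-monoʳ-≤ 2 (ball-expands free 2≤c deg i (<⇒≤ i<k))) ⟩
    B⁺ + 2 * B                ∎)
    where
    open ≤-Reasoning
    S B⁻ B B⁺ : ℕ
    S  = ∣Sphere∣ (suc i)
    B⁻ = ∣Ball∣ i
    B  = ∣Ball∣ (suc i)
    B⁺ = ∣Ball∣ (suc (suc i))
    c+2≤2c : c + 2 ≤ 2 * c
    c+2≤2c = +-monoʳ-≤ c (≤-trans 2≤c (m≤m+n c 0))

  ball-size : ∀ {k c} → Free (𝓒 k) D → 2 ≤ c → c + 2 + k ≤ δ⁺ D → ∀ i → i ≤ k → c ^ i ≤ ∣Ball∣ i
  ball-size free 2≤c deg zero _ = ≤-members (Ball? 0) ([] ∷ []) λ { (here v≡x) → v≡x }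
  ball-size {c = c} free 2≤c deg (suc i) i<k =
    ≤-trans (*-monoʳ-≤ c (ball-size free 2≤c deg i (<⇒≤ i<k))) (ball-expands free 2≤c deg i i<k)

𝓒-free⇒order : ∀ {n k c} (D : Digraph n) → Free (𝓒 k) D → 2 ≤ c → c + 2 + k ≤ δ⁺ D → c ^ k ≤ n
-- Without vertices `δ⁺` is 0 by convention and the degree hypothesis fails; otherwise the search
-- starts at vertex `zero`.
𝓒-free⇒order {zero} {c = zero} D free () deg
𝓒-free⇒order {zero} {c = suc c} D free 2≤c ()
𝓒-free⇒order {suc n} {k} D free 2≤c deg = begin
  _ ^ k                     ≤⟨ ball-size free 2≤c deg k ≤-refl ⟩
  ∣Ball∣ k                  ≤⟨ members-≤ (Ball? k) {allFin (suc n)} (λ _ → ∈-allFin _) ⟩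
  length (allFin (suc n))   ≡⟨ length-tabulate {n = suc n} id ⟩
  suc n                     ∎
  where
  open ≤-Reasoning
  open BreadthFirst D zero

-- Division with remainder

%-≡∧/-<⇒+n-≤ : ∀ {a b} n .{{_ : NonZero n}} → a % n ≡ b % n → a / n < b / n → a + n ≤ b
%-≡∧/-<⇒+n-≤ {a} {b} n r≡ q< = begin
  a + n                         ≡⟨ cong (_+ n) (m≡m%n+[m/n]*n a n) ⟩
  a % n + a / n * n + n         ≡⟨ +-assoc (a % n) _ n ⟩
  a % n + (a / n * n + n)       ≡⟨ cong (a % n +_) (+-comm _ n) ⟩
  a % n + suc (a / n) * n       ≤⟨ +-mono-≤ (≤-reflexive r≡) (*-monoˡ-≤ n q<) ⟩
  b % n + b / n * n             ≡⟨ sym (m≡m%n+[m/n]*n b n) ⟩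
  b                             ∎
  where open ≤-Reasoning

+-<-+-+ : ∀ a s {t n} → t < n → a + t < a + s + n
+-<-+-+ a s {n = n} t<n = <-≤-trans (+-monoʳ-< a t<n) (+-monoˡ-≤ n (m≤m+n a s))

-- With equal residues, different quotients would put the two numbers at least `n` apart, but both
-- lie in a window of length `n`.
%-cancelˡ : ∀ a {s t} n .{{_ : NonZero n}} → s < n → t < n → (a + s) % n ≡ (a + t) % n → s ≡ t
%-cancelˡ a {s} {t} n s<n t<n eq with <-cmp ((a + s) / n) ((a + t) / n)
... | tri< q< _ _ = contradiction (%-≡∧/-<⇒+n-≤ n eq q<) (<⇒≱ (+-<-+-+ a s t<n))
... | tri> _ _ q> = contradiction (%-≡∧/-<⇒+n-≤ n (sym eq) q>) (<⇒≱ (+-<-+-+ a t s<n))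
... | tri≈ _ q≡ _ = +-cancelˡ-≡ a s t (begin
  a + s                           ≡⟨ m≡m%n+[m/n]*n (a + s) n ⟩
  (a + s) % n + (a + s) / n * n   ≡⟨ cong₂ (λ r q → r + q * n) eq q≡ ⟩
  (a + t) % n + (a + t) / n * n   ≡⟨ sym (m≡m%n+[m/n]*n (a + t) n) ⟩
  a + t                           ∎)
  where open ≡-Reasoning

/-separates : ∀ {a b} m .{{_ : NonZero m}} → a + m ≤ b → a / m ≢ b / m
/-separates {a} {b} m a+m≤b q≡ = <⇒≱ (begin-strict
  b                   ≡⟨ m≡m%n+[m/n]*n b m ⟩
  b % m + b / m * m   <⟨ +-monoˡ-< _ (m%n<n b m) ⟩
  m + b / m * m       ≡⟨ cong (λ q → m + q * m) (sym q≡) ⟩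
  m + a / m * m       ≤⟨ +-monoʳ-≤ m (m/n*n≤m a m) ⟩
  m + a               ≡⟨ +-comm m a ⟩
  a + m               ∎) a+m≤b
  where open ≤-Reasoning

[m*[a%n]+r]%n : ∀ m a r n .{{_ : NonZero n}} → (m * (a % n) + r) % n ≡ (m * a + r) % n
[m*[a%n]+r]%n m a r n = begin
  (m * (a % n) + r) % n                          ≡⟨ sym ([m+kn]%n≡m%n _ (m * (a / n)) n) ⟩
  (m * (a % n) + r + m * (a / n) * n) % n        ≡⟨ cong (_% n) rearrange ⟩
  (m * a + r) % n                                ∎
  where
  open ≡-Reasoning
  rearrange : m * (a % n) + r + m * (a / n) * n ≡ m * a + r
  rearrange = begin
    m * (a % n) + r + m * (a / n) * n   ≡⟨ solve 5 (λ m x r y n → m :* x :+ r :+ m :* y :* n := m :* (x :+ y :* n) :+ r) refl m (a % n) r (a / n) n ⟩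
    m * (a % n + a / n * n) + r         ≡⟨ cong (λ z → m * z + r) (sym (m≡m%n+[m/n]*n a n)) ⟩
    m * a + r                           ∎

m*T+r<m*M : ∀ m {T r M} → T < M → r < m → m * T + r < m * M
m*T+r<m*M m {T} {r} {M} T<M r<m = begin-strict
  m * T + r   <⟨ +-monoʳ-< (m * T) r<m ⟩
  m * T + m   ≡⟨ +-comm (m * T) m ⟩
  m + m * T   ≡⟨ sym (*-suc m T) ⟩
  m * suc T   ≤⟨ *-monoʳ-≤ m T<M ⟩
  m * M       ∎
  where open ≤-Reasoning

m*T+r-quotient-unique : ∀ m .{{_ : NonZero m}} {T T′ r r′} → r < m → r′ < m →
  m * T + r ≡ m * T′ + r′ → T ≡ T′
m*T+r-quotient-unique m {T} {T′} {r} {r′} r<m r′<m eq =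
  *-cancelˡ-≡ T T′ m (+-cancelʳ-≡ r _ _ (trans eq (cong (m * T′ +_) (sym r≡r′))))
  where
  remainder : ∀ T {r} → r < m → (m * T + r) % m ≡ r
  remainder T {r} r<m = trans (cong (_% m) (trans (+-comm (m * T) r) (cong (r +_) (*-comm m T))))
                              (trans ([m+kn]%n≡m%n r T m) (m<n⇒m%n≡m r<m))
  r≡r′ : r ≡ r′
  r≡r′ = trans (sym (remainder T r<m)) (trans (cong (_% m) eq) (remainder T′ r′<m))

-- The Reddy-Imase digraph

module ReddyImase (n m : ℕ) .{{_ : NonZero n}} .{{_ : NonZero m}} (m≤n : m ≤ n) where

  Arc : Fin n → Fin n → Set
  Arc u v = ∃[ r ] (m * toℕ u + toℕ {m} r) % n ≡ toℕ v

  Adj? : ∀ u v → Dec (Arc u v × u ≢ v)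
  Adj? u v = any? (λ r → (m * toℕ u + toℕ r) % n ≟ toℕ v) ×-dec ¬? (u Fin.≟ v)

  G : Digraph n
  G .E u v = does (Adj? u v)
  G .loopless v = dec-false (Adj? v v) λ (_ , v≢v) → v≢v refl

  edge⇒arc : ∀ {u v} → Edge G u v → Arc u v
  edge⇒arc {u} {v} e = proj₁ (does-true⁻ (Adj? u v) e)

  target : Fin n → Fin m → Fin n
  target u r = fromℕ< (m%n<n (m * toℕ u + toℕ r) n)

  target-injective : ∀ u {r s} → target u r ≡ target u s → r ≡ s
  target-injective u {r} {s} eq = toℕ-injective (%-cancelˡ (m * toℕ u) n
    (<-≤-trans (toℕ<n r) m≤n) (<-≤-trans (toℕ<n s) m≤n)
    (trans (sym (toℕ-fromℕ< _)) (trans (cong toℕ eq) (toℕ-fromℕ< _))))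

  -- The `m` targets are distinct because `m ≤ n`; at most one of them is `u` itself, the removed
  -- loop.
  m≤1+outdeg : ∀ u → m ≤ suc (outdeg G u)
  m≤1+outdeg u = begin
    m                                          ≡⟨ sym (length-tabulate (target u)) ⟩
    length (tabulate (target u))               ≤⟨ unique-⊆⇒length-≤ (tabulate⁺ (target-injective u)) sub ⟩
    suc (length (outNeighbours G u))           ≡⟨ cong suc (sym (sum-indicator (E G u) (allFin n))) ⟩
    suc (outdeg G u)                           ∎
    where
    open ≤-Reasoning
    sub : ∀ {v} → v ∈ tabulate (target u) → v ∈ u ∷ outNeighbours G u
    sub v∈ with ∈-tabulate⁻ v∈
    ... | r , refl with u Fin.≟ target u r
    ...   | yes u≡ = here (sym u≡)
    ...   | no u≢  = there (∈-members (λ w → E G u w Bool.≟ true)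
                             (dec-true (Adj? u _) ((r , sym (toℕ-fromℕ< _)) , u≢)))

  lift : Fin n → Fin m → ℕ
  lift v j = toℕ v + toℕ j * n

  lift< : ∀ v j → lift v j < n * m
  lift< v j = begin-strict
    toℕ v + toℕ j * n   <⟨ +-monoˡ-< _ (toℕ<n v) ⟩
    suc (toℕ j) * n     ≤⟨ *-monoˡ-≤ n (toℕ<n j) ⟩
    m * n               ≡⟨ *-comm m n ⟩
    n * m               ∎
    where open ≤-Reasoning

  -- The in-neighbours of v are the quotients by m of the m numbers in [0, mn) congruent to v mod n.
  source : Fin n → Fin m → Fin n
  source v j = fromℕ< (m<n*o⇒m/o<n (lift< v j))

  source-arc : ∀ v j → Arc (source v j) v
  -- The digit is the remainder of the lift by `m`; together with the quotient it restores the lift,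
  -- which is `v` modulo `n`.
  source-arc v j = fromℕ< (m%n<n (lift v j) m) , (begin
    (m * toℕ (source v j) + toℕ (fromℕ< (m%n<n (lift v j) m))) % n ≡⟨ cong₂ (λ q r → (m * q + r) % n) (toℕ-fromℕ< (m<n*o⇒m/o<n (lift< v j))) (toℕ-fromℕ< (m%n<n (lift v j) m)) ⟩
    (m * (lift v j / m) + lift v j % m) % n ≡⟨ cong (_% n) (trans (+-comm _ (lift v j % m)) (cong (lift v j % m +_) (*-comm m _))) ⟩
    (lift v j % m + lift v j / m * m) % n   ≡⟨ cong (_% n) (sym (m≡m%n+[m/n]*n (lift v j) m)) ⟩
    lift v j % n                            ≡⟨ [m+kn]%n≡m%n (toℕ v) (toℕ j) n ⟩
    toℕ v % n                               ≡⟨ m<n⇒m%n≡m (toℕ<n v) ⟩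
    toℕ v                                   ∎)
    where open ≡-Reasoning

  lift-gap : ∀ v {i j} → toℕ i < toℕ j → lift v i + m ≤ lift v j
  lift-gap v {i} {j} i<j = begin
    toℕ v + toℕ i * n + m     ≡⟨ +-assoc (toℕ v) _ m ⟩
    toℕ v + (toℕ i * n + m)   ≤⟨ +-monoʳ-≤ (toℕ v) (+-monoʳ-≤ (toℕ i * n) m≤n) ⟩
    toℕ v + (toℕ i * n + n)   ≡⟨ cong (toℕ v +_) (+-comm _ n) ⟩
    toℕ v + suc (toℕ i) * n   ≤⟨ +-monoʳ-≤ (toℕ v) (*-monoˡ-≤ n i<j) ⟩
    toℕ v + toℕ j * n         ∎
    where open ≤-Reasoning

  -- Distinct lifts of `v` are at least `n ≥ m` apart, too far for a common quotient by `m`.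
  source-injective : ∀ v {i j} → source v i ≡ source v j → i ≡ j
  source-injective v {i} {j} eq with <-cmp (toℕ i) (toℕ j)
                                   | trans (sym (toℕ-fromℕ< _)) (trans (cong toℕ eq) (toℕ-fromℕ< _))
  ... | tri< i<j _ _ | q≡ = contradiction q≡ (/-separates m (lift-gap v i<j))
  ... | tri≈ _ i≡j _ | _  = toℕ-injective i≡j
  ... | tri> _ _ j<i | q≡ = contradiction (sym q≡) (/-separates m (lift-gap v j<i))

  m≤1+indeg : ∀ v → m ≤ suc (indeg G v)
  m≤1+indeg v = begin
    m                                                       ≡⟨ sym (length-tabulate (source v)) ⟩
    length (tabulate (source v))                            ≤⟨ unique-⊆⇒length-≤ (tabulate⁺ (source-injective v)) sub ⟩
    suc (length (members (λ w → E G w v Bool.≟ true)))      ≡⟨ cong suc (sym (sum-indicator (λ w → E G w v) (allFin n))) ⟩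
    suc (indeg G v)                                         ∎
    where
    open ≤-Reasoning
    sub : ∀ {u} → u ∈ tabulate (source v) → u ∈ v ∷ members (λ w → E G w v Bool.≟ true)
    sub u∈ with ∈-tabulate⁻ u∈
    ... | j , refl with source v j Fin.≟ v
    ...   | yes u≡ = here u≡
    ...   | no u≢  = there (∈-members (λ w → E G w v Bool.≟ true)
                             (dec-true (Adj? _ v) (source-arc v j , u≢)))

  m≤1+δ⁰ : m ≤ suc (δ⁰ G)
  m≤1+δ⁰ = ≤-trans (m≤n+m∸n m 1) (s≤s (⊓-glb (bound (outdeg G) m≤1+outdeg) (bound (indeg G) m≤1+indeg)))
    where
    bound : ∀ f → (∀ v → m ≤ suc (f v)) → m ∸ 1 ≤ minOver n f
    bound f h = ≤-minOver f (λ v → ∸-monoˡ-≤ 1 (h v))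

  -- A walk of length t from x ends at m^t x + T, where the base-m digits of T < m^t are
  -- the successive choices of r; so T determines the walk.
  walk-codes : ∀ t {w w′ : Fin (suc t) → Fin n} → IsWalk G t w → IsWalk G t w′ → w zero ≡ w′ zero →
    ∃[ T ] ∃[ T′ ] (T < m ^ t × T′ < m ^ t
      × toℕ (w (fromℕ t)) ≡ (m ^ t * toℕ (w zero) + T) % n
      × toℕ (w′ (fromℕ t)) ≡ (m ^ t * toℕ (w zero) + T′) % n
      × (T ≡ T′ → ∀ i → w i ≡ w′ i))
  walk-codes zero {w} {w′} _ _ start =
    0 , 0 , s≤s z≤n , s≤s z≤n , code , trans (cong toℕ (sym start)) code , λ { _ zero → start }
    where
    code : toℕ (w zero) ≡ (1 * toℕ (w zero) + 0) % n
    code = sym (trans (cong (_% n) (trans (+-identityʳ _) (*-identityˡ _))) (m<n⇒m%n≡m (toℕ<n (w zero))))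
  walk-codes (suc t) {w} {w′} walk walk′ start
    with walk-codes t {w ∘ inject₁} {w′ ∘ inject₁} (walk ∘ inject₁) (walk′ ∘ inject₁) start
       | edge⇒arc (walk (fromℕ t)) | edge⇒arc (walk′ (fromℕ t))
  ... | T , T′ , T< , T′< , code , code′ , determined | r , arc | r′ , arc′ =
    m * T + toℕ r , m * T′ + toℕ r′ , m*T+r<m*M m T< (toℕ<n r) , m*T+r<m*M m T′< (toℕ<n r′) ,
    extend code arc , extend code′ arc′ , same
    where
    x = toℕ (w zero)
    extend : ∀ {T u r v} → u ≡ (m ^ t * x + T) % n → (m * u + r) % n ≡ v →
      v ≡ (m ^ suc t * x + (m * T + r)) % n
    extend {T} {r = r} refl refl = trans ([m*[a%n]+r]%n m (m ^ t * x + T) r n) (cong (_% n)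
      (solve 5 (λ m M x T r → m :* (M :* x :+ T) :+ r := m :* M :* x :+ (m :* T :+ r)) refl m (m ^ t) x T r))
    -- Equal codes give equal last vertices; stripping the last digit leaves equal codes for the
    -- initial parts, where induction applies.
    same : m * T + toℕ r ≡ m * T′ + toℕ r′ → ∀ i → w i ≡ w′ i
    same eq i with view i
    ... | ‵fromℕ = toℕ-injective (trans (extend code arc)
          (trans (cong (λ S → (m ^ suc t * x + S) % n) eq) (sym (extend code′ arc′))))
    ... | ‵inj₁ {i = j} _ = determined (m*T+r-quotient-unique m (toℕ<n r) (toℕ<n r′) eq) j

  -- A common end fixes the code only modulo `n`, but codes are below `m ^ k ≤ n`, so it fixes the
  -- code and with it the walk.
  𝓕-free : ∀ {k} → m ^ k ≤ n → Free (𝓕 k) G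
  𝓕-free {k} m^k≤n h H (w , w′ , walk , walk′ , distinct , start , end , _) (φ , φ-inj , φ-edge)
    with walk-codes k {φ ∘ w} {φ ∘ w′} (λ i → φ-edge _ _ (walk i)) (λ i → φ-edge _ _ (walk′ i)) (cong φ start)
  ... | T , T′ , T< , T′< , code , code′ , determined =
    distinct λ i → φ-inj (determined
      (%-cancelˡ _ n (<-≤-trans T< m^k≤n) (<-≤-trans T′< m^k≤n)
        (trans (sym code) (trans (cong (toℕ ∘ φ) end) code′))) i)

-- Powers and integer roots

*-^ : ∀ a b k → (a * b) ^ k ≡ a ^ k * b ^ k
*-^ a b zero    = refl
*-^ a b (suc k) = trans (cong (a * b *_) (*-^ a b k)) ([m*n]*[o*p]≡[m*o]*[n*p] a b (a ^ k) (b ^ k))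

^-cancelˡ-< : ∀ k {a b} → a ^ k < b ^ k → a < b
^-cancelˡ-< k a^k<b^k = ≰⇒> λ b≤a → <⇒≱ a^k<b^k (^-monoˡ-≤ k b≤a)

-- Induction on `n`: the root rises by one exactly when the next power fits under the new number,
-- and it never rises by more.
root : ∀ k .{{_ : NonZero k}} n → ∃[ m ] (m ^ k ≤ n × n < suc m ^ k)
root k zero = 0 , ≤-reflexive (0^ k) , m^n>0 1 k
  where
  0^ : ∀ k .{{_ : NonZero k}} → 0 ^ k ≡ 0
  0^ (suc k) = refl
root k (suc n) with root k n
... | m , m^k≤n , n<[1+m]^k with suc m ^ k ≤? suc n
...   | yes [1+m]^k≤1+n = suc m , [1+m]^k≤1+n , ≤-<-trans n<[1+m]^k (^-monoˡ-< k (n<1+n (suc m)))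
...   | no  [1+m]^k≰1+n = m , m≤n⇒m≤1+n m^k≤n , ≰⇒> [1+m]^k≰1+n

-- The asymptotic inequalities

module Bounds {k} (2≤k : 2 ≤ k) {m0F mPC mPF : ℕ → ℕ}
  (m0F-spec : ∀ n → IsMZero (𝓕 k) n (m0F n))
  (mPC-spec : ∀ n → IsMPlus (𝓒 k) n (mPC n))
  (mPF-spec : ∀ n → IsMPlus (𝓕 k) n (mPF n)) where

  instance
    k≢0 : NonZero k
    k≢0 = >-nonZero (≤-trans (s≤s z≤n) 2≤k)

  -- Extending walks needs an out-edge at every vertex; when `δ⁺` is 0 the bound is trivial.
  𝓕-free⇒δ⁺≤mPC : ∀ {n} (D : Digraph n) → Free (𝓕 k) D → δ⁺ D ≤ mPC n
  𝓕-free⇒δ⁺≤mPC {n} D free with 1 ≤? δ⁺ D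
  ... | yes 1≤δ = proj₂ (mPC-spec n) D (𝓕-free⇒𝓒-free D 1≤δ free)
  ... | no 1≰δ  = ≤-trans (s≤s⁻¹ (≰⇒> 1≰δ)) z≤n

  m0F≤mPC : ∀ n → m0F n ≤ mPC n
  m0F≤mPC n with m0F-spec n
  ... | (D , free , eq) , _ = ≤-trans (≤-reflexive (sym eq)) (≤-trans (m⊓n≤m (δ⁺ D) _) (𝓕-free⇒δ⁺≤mPC D free))

  mPF≤mPC : ∀ n → mPF n ≤ mPC n
  mPF≤mPC n with mPF-spec n
  ... | (D , free , eq) , _ = ≤-trans (≤-reflexive (sym eq)) (𝓕-free⇒δ⁺≤mPC D free)

  m0F≤mPF : ∀ n → m0F n ≤ mPF n
  m0F≤mPF n with m0F-spec n
  ... | (D , free , eq) , _ =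
    ≤-trans (≤-reflexive (sym eq)) (≤-trans (m⊓n≤m (δ⁺ D) _) (proj₂ (mPF-spec n) D free))

  -- Witnessed by the Reddy-Imase digraph; the 1 pays for removed loops.
  m≤1+m0F : ∀ {m n} → 1 ≤ m → m ^ k ≤ n → m ≤ suc (m0F n)
  m≤1+m0F {m} {n} 1≤m m^k≤n = ≤-trans m≤1+δ⁰ (s≤s (proj₂ (m0F-spec n) G (𝓕-free m^k≤n)))
    where
    instance
      m≢0 : NonZero m
      m≢0 = >-nonZero 1≤m
    m≤n : m ≤ n
    m≤n = ≤-trans (≤-trans (≤-reflexive (sym (^-identityʳ m))) (^-monoʳ-≤ m (≤-trans (s≤s z≤n) 2≤k))) m^k≤n
    instance
      n≢0 : NonZero n
      n≢0 = >-nonZero (≤-trans 1≤m m≤n)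
    open ReddyImase n m m≤n

  -- A larger degree would allow `c = m + 1` in `𝓒-free⇒order`, giving `suc m ^ k ≤ n`; here `1 ≤ m`
  -- ensures `c ≥ 2`.
  mPC≤m+2+k : ∀ {m n} → 1 ≤ m → n < suc m ^ k → mPC n ≤ m + 2 + k
  mPC≤m+2+k {m} {n} 1≤m n<[1+m]^k with mPC-spec n
  ... | (D , free , eq) , _ = ≤-trans (≤-reflexive (sym eq))
    (≮⇒≥ λ m+2+k<δ → <⇒≱ n<[1+m]^k (𝓒-free⇒order D free (s≤s 1≤m) m+2+k<δ))

  rootOf : ∀ {N n} → N ^ k ≤ n → ∃[ m ] (N ≤ m × m ^ k ≤ n × n < suc m ^ k)
  rootOf N^k≤n with root k _
  ... | m , lower , upper = m , s≤s⁻¹ (^-cancelˡ-< k (≤-<-trans N^k≤n upper)) , lower , upper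

  -- As `k ≥ 2`, the factor `k ^ (k + 1)` is at least `2 ^ k`, so the gap yields `p * 2 < q`. The
  -- threshold gives `m ≥ 3`, hence `μ ≥ 2` and `m + 1 ≤ 2 + μ ≤ 2 * μ`.
  lower-bound : ∀ p q → p ^ k * k ^ (k + 1) < q ^ k →
    ∀ n → 3 ^ k ≤ n → p ^ k * n ≤ q ^ k * m0F n ^ k
  lower-bound p q gap n 3^k≤n with rootOf 3^k≤n
  ... | m , 3≤m , m^k≤n , n<[1+m]^k = begin
    p ^ k * n              ≤⟨ *-monoʳ-≤ (p ^ k) (<⇒≤ n<[1+m]^k) ⟩
    p ^ k * suc m ^ k      ≡⟨ sym (*-^ p (suc m) k) ⟩
    (p * suc m) ^ k        ≤⟨ ^-monoˡ-≤ k p[1+m]≤qμ ⟩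
    (q * m0F n) ^ k        ≡⟨ *-^ q (m0F n) k ⟩
    q ^ k * m0F n ^ k      ∎
    where
    open ≤-Reasoning
    μ = m0F n
    m≤1+μ : m ≤ suc μ
    m≤1+μ = m≤1+m0F (≤-trans (s≤s z≤n) 3≤m) m^k≤n
    p2<q : p * 2 < q
    p2<q = ^-cancelˡ-< k (begin-strict
      (p * 2) ^ k            ≡⟨ *-^ p 2 k ⟩
      p ^ k * 2 ^ k          ≤⟨ *-monoʳ-≤ (p ^ k) (≤-trans (^-monoˡ-≤ k 2≤k) (^-monoʳ-≤ k (m≤m+n k 1))) ⟩
      p ^ k * k ^ (k + 1)    <⟨ gap ⟩
      q ^ k                  ∎)
    p[1+m]≤qμ : p * suc m ≤ q * μ
    p[1+m]≤qμ = begin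
      p * suc m       ≤⟨ *-monoʳ-≤ p (s≤s m≤1+μ) ⟩
      p * (2 + μ)     ≤⟨ *-monoʳ-≤ p (+-monoˡ-≤ μ (s≤s⁻¹ (≤-trans 3≤m m≤1+μ))) ⟩
      p * (μ + μ)     ≡⟨ solve 2 (λ p μ → p :* (μ :+ μ) := p :* con 2 :* μ) refl p μ ⟩
      p * 2 * μ       ≤⟨ *-monoˡ-≤ μ (<⇒≤ p2<q) ⟩
      q * μ           ∎

  -- The threshold makes `m ≥ k + 3`, so `k + 2 ≤ μ` and the additive error is absorbed: `m + 2 + k
  -- ≤ 1 + 2 * μ ≤ 4 * μ ≤ 2 * k * μ`.
  comparison : ∀ p q → 2 * k * q < p → ∀ n → (k + 3) ^ k ≤ n → q * mPC n ≤ p * mPF n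
  comparison p q gap n N≤n with rootOf N≤n
  ... | m , k+3≤m , m^k≤n , n<[1+m]^k = begin
    q * mPC n              ≤⟨ *-monoʳ-≤ q (mPC≤m+2+k 1≤m n<[1+m]^k) ⟩
    q * (m + 2 + k)        ≡⟨ cong (q *_) (solve 2 (λ m k → m :+ con 2 :+ k := m :+ (k :+ con 2)) refl m k) ⟩
    q * (m + (k + 2))      ≤⟨ *-monoʳ-≤ q (+-mono-≤ m≤1+μ k+2≤μ) ⟩
    q * (1 + μ + μ)        ≤⟨ *-monoʳ-≤ q (+-monoˡ-≤ μ (+-monoˡ-≤ μ 1≤μ)) ⟩
    q * (μ + μ + μ)        ≤⟨ *-monoʳ-≤ q (m≤m+n (μ + μ + μ) μ) ⟩
    q * (μ + μ + μ + μ)    ≡⟨ solve 2 (λ q μ → q :* (μ :+ μ :+ μ :+ μ) := con 2 :* con 2 :* q :* μ) refl q μ ⟩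
    2 * 2 * q * μ          ≤⟨ *-monoˡ-≤ μ (*-monoˡ-≤ q (*-monoʳ-≤ 2 2≤k)) ⟩
    2 * k * q * μ          ≤⟨ *-mono-≤ (<⇒≤ gap) (m0F≤mPF n) ⟩
    p * mPF n              ∎
    where
    open ≤-Reasoning
    μ = m0F n
    1≤m : 1 ≤ m
    1≤m = ≤-trans (≤-trans (s≤s z≤n) (m≤n+m 3 k)) k+3≤m
    m≤1+μ : m ≤ suc μ
    m≤1+μ = m≤1+m0F 1≤m m^k≤n
    k+2≤μ : k + 2 ≤ μ
    k+2≤μ = s≤s⁻¹ (≤-trans (≤-reflexive (sym (+-suc k 2))) (≤-trans k+3≤m m≤1+μ))
    1≤μ : 1 ≤ μ
    1≤μ = ≤-trans (≤-trans (s≤s z≤n) (m≤n+m 2 k)) k+2≤μ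

  -- The threshold makes `m` exceed `q * (2 + k)`, so the additive error costs at most one more `m`,
  -- and `q + 1 ≤ p`.
  upper-bound : ∀ p q → q < p → ∀ n → suc (q * (2 + k)) ^ k ≤ n → q ^ k * mPF n ^ k ≤ p ^ k * n
  upper-bound p q q<p n N≤n with rootOf N≤n
  ... | m , q[2+k]<m , m^k≤n , n<[1+m]^k = begin
    q ^ k * mPF n ^ k      ≡⟨ sym (*-^ q (mPF n) k) ⟩
    (q * mPF n) ^ k        ≤⟨ ^-monoˡ-≤ k q*mPF≤p*m ⟩
    (p * m) ^ k            ≡⟨ *-^ p m k ⟩
    p ^ k * m ^ k          ≤⟨ *-monoʳ-≤ (p ^ k) m^k≤n ⟩
    p ^ k * n              ∎
    where
    open ≤-Reasoning
    q*mPF≤p*m : q * mPF n ≤ p * m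
    q*mPF≤p*m = begin
      q * mPF n             ≤⟨ *-monoʳ-≤ q (≤-trans (mPF≤mPC n) (mPC≤m+2+k (≤-trans (s≤s z≤n) q[2+k]<m) n<[1+m]^k)) ⟩
      q * (m + 2 + k)       ≡⟨ cong (q *_) (+-assoc m 2 k) ⟩
      q * (m + (2 + k))     ≡⟨ *-distribˡ-+ q m (2 + k) ⟩
      q * m + q * (2 + k)   ≤⟨ +-monoʳ-≤ (q * m) (<⇒≤ q[2+k]<m) ⟩
      q * m + m             ≡⟨ +-comm (q * m) m ⟩
      suc q * m             ≤⟨ *-monoˡ-≤ m q<p ⟩
      p * m                 ∎

-- Each o(1) is expressed by a rational `p / q` strictly on the allowed side of the constant and a
-- threshold `N`. Roots are cleared by `k`-th powers: `p ^ k * k ^ (k + 1) < q ^ k` says that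
-- `p / q` is below 1 / k^(1+1/k).
theorem1p12 : (k : ℕ) → 2 ≤ k →
    (m0F mPC mPF : ℕ → ℕ) →
    (∀ n → IsMZero (𝓕 k) n (m0F n)) →
    (∀ n → IsMPlus (𝓒 k) n (mPC n)) →
    (∀ n → IsMPlus (𝓕 k) n (mPF n)) →
    ((p q : ℕ) → 0 < q → p ^ k * k ^ (k + 1) < q ^ k →
    Σ ℕ λ N → ∀ n → N ≤ n → p ^ k * n ≤ q ^ k * m0F n ^ k)
    × (∀ n → m0F n ≤ mPC n)
    × ((p q : ℕ) → 0 < q → 2 * k * q < p →
    Σ ℕ λ N → ∀ n → N ≤ n → q * mPC n ≤ p * mPF n)
    × ((p q : ℕ) → 0 < q → q < p →
    Σ ℕ λ N → ∀ n → N ≤ n → q ^ k * mPF n ^ k ≤ p ^ k * n)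
theorem1p12 k 2≤k m0F mPC mPF m0F-spec mPC-spec mPF-spec =
    (λ p q _ gap → 3 ^ k , lower-bound p q gap)
  , m0F≤mPC
  , (λ p q _ gap → (k + 3) ^ k , comparison p q gap)
  , (λ p q _ q<p → suc (q * (2 + k)) ^ k , upper-bound p q q<p)
  where open Bounds 2≤k m0F-spec mPC-spec mPF-spec
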